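{- For any finite simple undirected graph $G$ of order $n\ge 1$, $\kappa'(G)\ge \frac{n}{n-\delta}$, where $\delta$ is the minimum degree of $G$.
   Context: For a graph $G=(V,E)$ and $C\subseteq V$, let $Odd(C)=\{v\in V : |N(v)\cap C|\equiv 1 \pmod 2\}$, where $N(v)$ is the open neighborhood of $v$. A set $B\subseteq V$ is a weak odd dominated (WOD) set if there exists $C\subseteq V\setminus B$ with $B\subseteq Odd(C)$. $\kappa'(G)$ is the minimum size of a subset of $V$ that is not a WOD set. -}

module Defs where

open import Data.Fin.Base using (Fin; fromℕ<)
open import Data.Fin.Subset
  using (Subset; inside; outside; _∈_; _⊆_; _∩_; ∁; ⊤; ⊥; ∣_∣)
open import Data.Fin.Subset.Properties
  using (_⊆?_; anySubset?; ∈⊤; x∈∁p⇒x∉p; p∩q⊆q; Empty-unique; ∣⊥∣≡0; ∣p∣≤n; ∣p∣≡n⇒p≡⊤)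
open import Data.List.Base using (List; [_]; _++_; map; filter; allFin)
open import Data.List.Extrema.Nat using (argmin; argmin-all; f[argmin]≤f[xs])
import Data.List.Membership.Propositional as List
open import Data.List.Membership.Propositional.Properties
  using (∈-map⁺; ∈-++⁺ˡ; ∈-++⁺ʳ; ∈-filter⁺; ∈-allFin)
open import Data.List.Relation.Unary.All using (lookup)
open import Data.List.Relation.Unary.All.Properties using (all-filter)
open import Data.List.Relation.Unary.Any using (here)
open import Data.Nat.Base
  using (ℕ; zero; suc; _≤_; _<_; _∸_; _%_; NonZero; >-nonZero; >-nonZero⁻¹)
open import Data.Nat.Properties using (_≟_; ≤∧≢⇒<; m<n⇒0<n∸m)
open import Data.Product.Base using (_×_; _,_; ∃-syntax)
open import Data.Vec.Base using ([]; _∷_; tabulate)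
open import Data.Vec.Properties using (lookup∘tabulate; []=⇒lookup; lookup⇒[]=)
open import Function.Base using (_∘_)
open import Level using (0ℓ)
open import Relation.Binary.Core using (Rel)
open import Relation.Binary.Definitions using (Decidable; Irreflexive; Symmetric)
open import Relation.Binary.PropositionalEquality
  using (_≡_; refl; sym; trans; cong; subst)
open import Relation.Nullary.Decidable using (yes; no; does; _×-dec_; ¬?; dec-true)
open import Relation.Nullary.Negation using (¬_; contradiction)
open import Relation.Unary using (Pred)
import Relation.Unary as Unary

record Graph (n : ℕ) : Set₁ where
  infix 4 _~_ _~?_
  field
    _~_      : Rel (Fin n) 0ℓ
    _~?_     : Decidable _~_
    ~-sym    : Symmetric _~_
    ~-irrefl : Irreflexive _≡_ _~_

module _ {n : ℕ} where

  comprehension : {P : Pred (Fin n) 0ℓ} → Unary.Decidable P → Subset n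
  comprehension P? = tabulate (λ v → does (P? v))

  module _ {P : Pred (Fin n) 0ℓ} (P? : Unary.Decidable P) where

    ∈-comprehension⁺ : ∀ {v} → P v → v ∈ comprehension P?
    ∈-comprehension⁺ {v} p =
      lookup⇒[]= v _ (trans (lookup∘tabulate _ v) (dec-true (P? v) p))

    ∈-comprehension⁻ : ∀ {v} → v ∈ comprehension P? → P v
    ∈-comprehension⁻ {v} v∈ with P? v | trans (sym (lookup∘tabulate (does ∘ P?) v)) ([]=⇒lookup v∈)
    ... | yes p | _  = p
    ... | no  _ | ()

module _ {n : ℕ} (G : Graph n) where
  open Graph G

  N : Fin n → Subset n
  N v = comprehension (v ~?_)

  degree : Fin n → ℕ
  degree v = ∣ N v ∣

  Odd : Subset n → Subset n
  Odd C = comprehension (λ v → ∣ N v ∩ C ∣ % 2 ≟ 1)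

  WOD : Subset n → Set
  WOD B = ∃[ C ] (C ⊆ ∁ B × B ⊆ Odd C)

  WOD? : Unary.Decidable WOD
  WOD? B = anySubset? (λ C → (C ⊆? ∁ B) ×-dec (B ⊆? Odd C))

subsets : ∀ n → List (Subset n)
subsets zero    = [ [] ]
subsets (suc n) = map (inside ∷_) (subsets n) ++ map (outside ∷_) (subsets n)

∈-subsets : ∀ {n} (B : Subset n) → B List.∈ subsets n
∈-subsets []            = here refl
∈-subsets (inside  ∷ B) = ∈-++⁺ˡ (∈-map⁺ (inside ∷_) (∈-subsets B))
∈-subsets (outside ∷ B) =
  ∈-++⁺ʳ (map (inside ∷_) (subsets _)) (∈-map⁺ (outside ∷_) (∈-subsets B))

module _ {n : ℕ} .{{_ : NonZero n}} (G : Graph n) where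
  open Graph G

  -- argmin also ranges over its second argument, which must therefore be
  -- admissible itself: any vertex for δ, and the whole vertex set, which is
  -- never WOD, for κ′.

  private
    minDegreeVertex : Fin n
    minDegreeVertex = argmin (degree G) (fromℕ< (>-nonZero⁻¹ n)) (allFin n)

    smallestNonWOD : Subset n
    smallestNonWOD = argmin ∣_∣ ⊤ (filter (¬? ∘ WOD? G) (subsets n))

  δ : ℕ
  δ = degree G minDegreeVertex

  κ′ : ℕ
  κ′ = ∣ smallestNonWOD ∣

  δ-attained : ∃[ v ] degree G v ≡ δ
  δ-attained = minDegreeVertex , refl

  δ-minimal : ∀ v → δ ≤ degree G v
  δ-minimal v = lookup (f[argmin]≤f[xs] _ (allFin n)) (∈-allFin v)

  ⊤-nonWOD : ¬ WOD G ⊤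
  ⊤-nonWOD (C , C⊆∁⊤ , ⊤⊆Odd) = contradiction 0%2≡1 λ ()
    where
    v : Fin n
    v = fromℕ< (>-nonZero⁻¹ n)

    N∩C≡⊥ : N G v ∩ C ≡ ⊥
    N∩C≡⊥ = Empty-unique λ (x , x∈N∩C) →
      x∈∁p⇒x∉p (C⊆∁⊤ (p∩q⊆q (N G v) C x∈N∩C)) ∈⊤

    ∣N∩C∣≡0 : ∣ N G v ∩ C ∣ ≡ 0
    ∣N∩C∣≡0 = trans (cong ∣_∣ N∩C≡⊥) (∣⊥∣≡0 n)

    0%2≡1 : 0 % 2 ≡ 1
    0%2≡1 = subst (λ k → k % 2 ≡ 1) ∣N∩C∣≡0
      (∈-comprehension⁻ (λ u → ∣ N G u ∩ C ∣ % 2 ≟ 1) (⊤⊆Odd {v} ∈⊤))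

  κ′-attained : ∃[ B ] (¬ WOD G B × ∣ B ∣ ≡ κ′)
  κ′-attained = smallestNonWOD
              , argmin-all ∣_∣ ⊤-nonWOD (all-filter (¬? ∘ WOD? G) (subsets n))
              , refl

  κ′-minimal : ∀ {B} → ¬ WOD G B → κ′ ≤ ∣ B ∣
  κ′-minimal {B} ¬wod = lookup (f[argmin]≤f[xs] _ _)
    (∈-filter⁺ (¬? ∘ WOD? G) (∈-subsets B) ¬wod)

  δ<n : δ < n
  δ<n = ≤∧≢⇒< (∣p∣≤n (N G minDegreeVertex)) λ δ≡n →
    ~-irrefl refl (∈-comprehension⁻ (minDegreeVertex ~?_)
      (subst (minDegreeVertex ∈_) (sym (∣p∣≡n⇒p≡⊤ δ≡n)) ∈⊤))

  n∸δ-nonZero : NonZero (n ∸ δ)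
  n∸δ-nonZero = >-nonZero (m<n⇒0<n∸m δ<n)

{-# OPTIONS --safe #-}

-- If a vertex v outside B were adjacent to every vertex of B, then C = {v}
-- would witness that B is WOD. So when B is not WOD, every vertex is a
-- non-neighbour of some vertex of B (a vertex of B being a non-neighbour of
-- itself). Each vertex has at most n ∸ δ non-neighbours, itself included,
-- hence n ≤ ∣ B ∣ * (n ∸ δ).

module Submission where

open import Defs
open import Data.Fin.Base using (Fin; zero; suc)
open import Data.Fin.Properties using (any?)
open import Data.Fin.Subset
  using (Subset; inside; outside; _∈_; _∉_; _⊆_; _∪_; _∩_; ∁; ⊤; ⊥; ⁅_⁆; ∣_∣)
open import Data.Fin.Subset.Properties
  using ( _∈?_; ∣⊥∣≡0; ∣⊤∣≡n; ∣∁p∣≡n∸∣p∣; ∣⁅x⁆∣≡1; x∈⁅y⁆⇒x≡y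
        ; x∉p⇒x∈∁p; p∩q⊆q; x∈p∩q⁺; p⊆p∪q; q⊆p∪q; ⊆-antisym; p⊆q⇒∣p∣≤∣q∣)
open import Data.Integer.Base using (+_; +≤+) renaming (_≤_ to _≤ℤ_)
open import Data.Integer.Properties using (pos-*)
open import Data.Nat.Base using (ℕ; suc; NonZero; _+_; _*_; _∸_; _%_; _≤_; z≤n; s≤s)
open import Data.Nat.Properties
  using ( _≟_; ≤-reflexive; ≤-trans; +-mono-≤; +-suc; *-identityʳ; m≤n⇒m≤1+n
        ; ∸-monoʳ-≤; module ≤-Reasoning)
open import Data.Product.Base using (_×_; _,_; ∃-syntax)
open import Data.Rational.Base using (_/_; _≥_; toℚᵘ; fromℚᵘ) renaming (_≤_ to _≤ℚ_)
open import Data.Rational.Properties using (toℚᵘ-cancel-≤; toℚᵘ-fromℚᵘ)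
open import Data.Rational.Unnormalised.Base as ℚᵘ using (mkℚᵘ)
open import Data.Rational.Unnormalised.Properties
  using () renaming (module ≤-Reasoning to ≤ᵘ-Reasoning)
open import Data.Vec.Base using ([]; _∷_; here; there)
open import Function.Base using (_∘_)
open import Relation.Binary.PropositionalEquality
  using (_≡_; refl; sym; trans; cong; subst; subst₂)
open import Relation.Nullary.Decidable using (yes; no; _×-dec_; ¬?; decidable-stable)
open import Relation.Nullary.Negation using (¬_; contradiction)

∣p∪q∣≤∣p∣+∣q∣ : ∀ {n} (p q : Subset n) → ∣ p ∪ q ∣ ≤ ∣ p ∣ + ∣ q ∣
∣p∪q∣≤∣p∣+∣q∣ []            []            = z≤n
∣p∪q∣≤∣p∣+∣q∣ (outside ∷ p) (outside ∷ q) = ∣p∪q∣≤∣p∣+∣q∣ p q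
∣p∪q∣≤∣p∣+∣q∣ (inside  ∷ p) (outside ∷ q) = s≤s (∣p∪q∣≤∣p∣+∣q∣ p q)
∣p∪q∣≤∣p∣+∣q∣ (outside ∷ p) (inside  ∷ q) =
  ≤-trans (s≤s (∣p∪q∣≤∣p∣+∣q∣ p q)) (≤-reflexive (sym (+-suc ∣ p ∣ ∣ q ∣)))
∣p∪q∣≤∣p∣+∣q∣ (inside  ∷ p) (inside  ∷ q) =
  -- A common element counts once on the left and twice on the right, hence the extra weakening by
  -- one.
  s≤s (≤-trans (m≤n⇒m≤1+n (∣p∪q∣≤∣p∣+∣q∣ p q)) (≤-reflexive (sym (+-suc ∣ p ∣ ∣ q ∣))))

x∈p⇒p∩⁅x⁆≡⁅x⁆ : ∀ {n} {x : Fin n} {p : Subset n} → x ∈ p → p ∩ ⁅ x ⁆ ≡ ⁅ x ⁆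
x∈p⇒p∩⁅x⁆≡⁅x⁆ {x = x} {p} x∈p = ⊆-antisym (p∩q⊆q p ⁅ x ⁆) λ y∈⁅x⁆ →
  x∈p∩q⁺ (subst (_∈ p) (sym (x∈⁅y⁆⇒x≡y x y∈⁅x⁆)) x∈p , y∈⁅x⁆)

-- The sizes `m` and `n` are kept apart so that the recursion can shorten the index set while the
-- united sets remain subsets of `Fin n`.
⋃[_] : ∀ {m n} → Subset m → (Fin m → Subset n) → Subset n
⋃[ []          ] f = ⊥
⋃[ inside  ∷ I ] f = f zero ∪ ⋃[ I ] (f ∘ suc)
⋃[ outside ∷ I ] f = ⋃[ I ] (f ∘ suc)

f[i]⊆⋃ : ∀ {m n} {I : Subset m} (f : Fin m → Subset n) {i} → i ∈ I → f i ⊆ ⋃[ I ] f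
f[i]⊆⋃ {I = inside  ∷ I} f here        = p⊆p∪q _
f[i]⊆⋃ {I = inside  ∷ I} f (there i∈I) = q⊆p∪q (f zero) _ ∘ f[i]⊆⋃ (f ∘ suc) i∈I
f[i]⊆⋃ {I = outside ∷ I} f (there i∈I) = f[i]⊆⋃ (f ∘ suc) i∈I

∣⋃∣≤∣I∣*k : ∀ {m n k} (I : Subset m) (f : Fin m → Subset n) →
            (∀ i → ∣ f i ∣ ≤ k) → ∣ ⋃[ I ] f ∣ ≤ ∣ I ∣ * k
∣⋃∣≤∣I∣*k {n = n} []    f ∣f∣≤k = ≤-reflexive (∣⊥∣≡0 n)
∣⋃∣≤∣I∣*k (inside  ∷ I) f ∣f∣≤k = ≤-trans (∣p∪q∣≤∣p∣+∣q∣ (f zero) _)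
  (+-mono-≤ (∣f∣≤k zero) (∣⋃∣≤∣I∣*k I (f ∘ suc) (∣f∣≤k ∘ suc)))
∣⋃∣≤∣I∣*k (outside ∷ I) f ∣f∣≤k = ∣⋃∣≤∣I∣*k I (f ∘ suc) (∣f∣≤k ∘ suc)

-- Normalising a fraction preserves it up to `≃`, so the comparison can be made before normalising.
fromℚᵘ-mono-≤ : ∀ {p q} → p ℚᵘ.≤ q → fromℚᵘ p ≤ℚ fromℚᵘ q
fromℚᵘ-mono-≤ {p} {q} p≤q = toℚᵘ-cancel-≤ (begin
  toℚᵘ (fromℚᵘ p)  ≃⟨ toℚᵘ-fromℚᵘ p ⟩
  p                ≤⟨ p≤q ⟩
  q                ≃⟨ toℚᵘ-fromℚᵘ q ⟨
  toℚᵘ (fromℚᵘ q)  ∎)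
  where open ≤ᵘ-Reasoning

m≤k*d⇒k/1≥m/d : ∀ m k d .{{_ : NonZero d}} → m ≤ k * d → (+ k) / 1 ≥ (+ m) / d
m≤k*d⇒k/1≥m/d m k (suc d-1) m≤k*d =
  -- `mkℚᵘ` stores the denominator minus one, so `d-1` and `0` encode `d` and 1. Cross-multiplied,
  -- the inequality reads `m * 1 ≤ k * d`.
  fromℚᵘ-mono-≤ {mkℚᵘ (+ m) d-1} {mkℚᵘ (+ k) 0}
    (ℚᵘ.*≤* (subst₂ _≤ℤ_ (pos-* m 1) (pos-* k (suc d-1))
      (+≤+ (subst (_≤ k * suc d-1) (sym (*-identityʳ m)) m≤k*d))))

module _ {n : ℕ} (G : Graph n) where
  open Graph G

  dominating⇒WOD : ∀ {B v} → v ∉ B → (∀ {b} → b ∈ B → b ~ v) → WOD G B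
  dominating⇒WOD {B} {v} v∉B B~v = ⁅ v ⁆ , ⁅v⁆⊆∁B , B⊆Odd
    where
    ⁅v⁆⊆∁B : ⁅ v ⁆ ⊆ ∁ B
    ⁅v⁆⊆∁B x∈⁅v⁆ = subst (_∈ ∁ B) (sym (x∈⁅y⁆⇒x≡y v x∈⁅v⁆)) (x∉p⇒x∈∁p v∉B)

    B⊆Odd : B ⊆ Odd G ⁅ v ⁆
    -- As `v` lies in `N G b`, the intersection is all of `⁅ v ⁆`, and its size 1 is odd.
    B⊆Odd {b} b∈B = ∈-comprehension⁺ (λ u → ∣ N G u ∩ ⁅ v ⁆ ∣ % 2 ≟ 1) (cong (_% 2) (trans
      (cong ∣_∣ (x∈p⇒p∩⁅x⁆≡⁅x⁆ (∈-comprehension⁺ (b ~?_) (B~v b∈B))))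
      (∣⁅x⁆∣≡1 v)))

  nonWOD⇒nonNeighbour : ∀ {B} → ¬ WOD G B → ∀ v → ∃[ b ] (b ∈ B × ¬ b ~ v)
  nonWOD⇒nonNeighbour {B} ¬wod v
    with v ∈? B | any? (λ b → (b ∈? B) ×-dec ¬? (b ~? v))
  ... | yes v∈B | _     = v , v∈B , ~-irrefl refl
  ... | no  _   | yes w = w
  -- The failed search only refutes non-adjacency for each `b` in `B`; decidability of `~` turns
  -- this into adjacency.
  ... | no  v∉B | no ∄b = contradiction
    (dominating⇒WOD v∉B λ {b} b∈B → decidable-stable (b ~? v) λ b≁v → ∄b (b , b∈B , b≁v))
    ¬wod

  -- A non-neighbour `b` of `v` in `B` places `v` in `∁ (N G b)`. The neighbourhood is open, so this
  -- complement also contains `b` itself.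
  nonWOD⇒⊤⊆⋃∁N : ∀ {B} → ¬ WOD G B → ⊤ ⊆ ⋃[ B ] (∁ ∘ N G)
  nonWOD⇒⊤⊆⋃∁N ¬wod {v} _ with nonWOD⇒nonNeighbour ¬wod v
  ... | b , b∈B , b≁v =
    f[i]⊆⋃ (∁ ∘ N G) b∈B (x∉p⇒x∈∁p (b≁v ∘ ∈-comprehension⁻ (b ~?_)))

  module _ .{{_ : NonZero n}} where

    ∣∁N∣≤n∸δ : ∀ v → ∣ ∁ (N G v) ∣ ≤ n ∸ δ G
    ∣∁N∣≤n∸δ v = ≤-trans (≤-reflexive (∣∁p∣≡n∸∣p∣ (N G v))) (∸-monoʳ-≤ n (δ-minimal G v))

    nonWOD⇒n≤∣B∣*[n∸δ] : ∀ {B} → ¬ WOD G B → n ≤ ∣ B ∣ * (n ∸ δ G)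
    nonWOD⇒n≤∣B∣*[n∸δ] {B} ¬wod = begin
      n                     ≡⟨ ∣⊤∣≡n n ⟨
      ∣ ⊤ {n} ∣             ≤⟨ p⊆q⇒∣p∣≤∣q∣ (nonWOD⇒⊤⊆⋃∁N ¬wod) ⟩
      ∣ ⋃[ B ] (∁ ∘ N G) ∣  ≤⟨ ∣⋃∣≤∣I∣*k B (∁ ∘ N G) ∣∁N∣≤n∸δ ⟩
      ∣ B ∣ * (n ∸ δ G)     ∎
      where open ≤-Reasoning

lemma5 : ∀ {n : ℕ} .{{_ : NonZero n}} (G : Graph n) →
    (+ κ′ G) / 1 ≥ ((+ n) / (n ∸ δ G)) {{n∸δ-nonZero G}}
lemma5 {n} G =
  -- The bound holds for every non-WOD set; a smallest one turns `∣ B ∣` into `κ′ G`.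
  let _ , ¬wod , ∣B∣≡κ′ = κ′-attained G
  in m≤k*d⇒k/1≥m/d n (κ′ G) (n ∸ δ G) {{n∸δ-nonZero G}}
       (subst (λ k → n ≤ k * (n ∸ δ G)) ∣B∣≡κ′ (nonWOD⇒n≤∣B∣*[n∸δ] G ¬wod))
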